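{- For every $k \geq 2$ and every $m$ with $k \le m \le 2k-2$, the number of Grassmannian permutations of $[m]$ that avoid $\operatorname{id}_k = 12\cdots k$ equals \[ \sum_{j=1}^{2k-m} (-1)^{j-1}\, j \binom{2k-m-j}{j} C_{k-j}, \] where $C_n = \frac{1}{n+1}\binom{2n}{n}$ is the $n$-th Catalan number (and $\binom{a}{b}=0$ when $b>a\ge 0$).
   Context: A permutation of $[m]$ is Grassmannian if it has at most one descent (one-line notation). A permutation $\sigma$ contains a pattern $\pi$ of size $k$ if some subsequence of $\sigma$ of length $k$ is order-isomorphic to $\pi$; otherwise $\sigma$ avoids $\pi$. -}

module Defs where

open import Data.Fin.Base using (Fin; toℕ; _<_)
open import Data.Fin.Permutation using (Permutation′; _⟨$⟩ʳ_; _≈_)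
open import Data.Integer.Base as ℤ using (ℤ; +_; -1ℤ)
open import Data.Integer.Properties using (+-0-commutativeMonoid)
open import Data.Nat.Base using (ℕ; suc; _*_; _∸_; _/_)
open import Data.Nat.Combinatorics using (_C_)
open import Data.Product.Base using (Σ; _×_; proj₁)
open import Function.Bundles using (_⇔_; Inverse)
open import Level using (0ℓ)
open import Relation.Binary.Bundles using (Setoid)
open import Relation.Binary.PropositionalEquality using (_≡_; refl; sym; trans; setoid)
open import Relation.Nullary.Negation using (¬_)

open import Algebra.Properties.CommutativeMonoid.Sum +-0-commutativeMonoid using (sum-syntax)

private
  variable
    m k : ℕ

-- The one-line notation of σ is the word σ ⟨$⟩ʳ 0, …, σ ⟨$⟩ʳ (m - 1);
-- positions and values are indexed from 0, so Fin m plays the role of [m].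

IsDescent : Permutation′ m → Fin m → Set
IsDescent {m} σ i =
  Σ (Fin m) λ i⁺ → toℕ i⁺ ≡ suc (toℕ i) × (σ ⟨$⟩ʳ i⁺) < (σ ⟨$⟩ʳ i)

IsGrassmannian : Permutation′ m → Set
IsGrassmannian σ = ∀ i j → IsDescent σ i → IsDescent σ j → i ≡ j

-- The function ι lists the positions of the chosen subsequence.
Contains : Permutation′ m → Permutation′ k → Set
Contains {m} {k} σ π =
  Σ (Fin k → Fin m) λ ι →
    (∀ i j → i < j → ι i < ι j) ×
    (∀ i j → ((π ⟨$⟩ʳ i) < (π ⟨$⟩ʳ j)) ⇔ ((σ ⟨$⟩ʳ ι i) < (σ ⟨$⟩ʳ ι j)))

Avoids : Permutation′ m → Permutation′ k → Set
Avoids σ π = ¬ Contains σ π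

-- The subset of the permutations of [m] cut out by P.  Two elements are
-- identified when they are the same function; the stored inverse and the
-- proofs are irrelevant.
permutationsSatisfying : (Permutation′ m → Set) → Setoid 0ℓ 0ℓ
permutationsSatisfying {m} P = record
  { Carrier       = Σ (Permutation′ m) P
  ; _≈_           = λ s t → proj₁ s ≈ proj₁ t
  ; isEquivalence = record
    { refl  = λ _ → refl
    ; sym   = λ p i → sym (p i)
    ; trans = λ p q i → trans (p i) (q i)
    }
  }

HasCardinality : Setoid 0ℓ 0ℓ → ℕ → Set
HasCardinality S n = Inverse S (setoid (Fin n))

-- The natural-number division is exact: suc n always divides (2 * n) C n.
catalan : ℕ → ℕ
catalan n = ((2 * n) C n) / suc n

-- For 1 ≤ j ≤ 2k - m and k ≤ m, none of the truncated subtractions truncates.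
summand : ℕ → ℕ → ℕ → ℤ
summand k m j =
  (-1ℤ ℤ.^ (j ∸ 1)) ℤ.* + (j * ((2 * k ∸ m ∸ j) C j) * catalan (k ∸ j))

-- The library sum runs over i = 0, …, 2k - m - 1; the index is j = i + 1.
alternatingSum : ℕ → ℕ → ℤ
alternatingSum k m = ∑[ i < 2 * k ∸ m ] summand k m (suc (toℕ i))

{-# OPTIONS --safe #-}

-- A Grassmannian permutation with its descent at position d is determined by
-- the set of its first d values, recorded as a binary word w (the v-th letter is
-- true when the value v is among them).  Only the identity comes from several
-- words, and it contains id_k because k ≤ m.  An increasing subsequence of the
-- permutation is a subsequence true … true false … false of w, so avoiding id_k
-- means lis w < k.
--
-- Write U(m,k) for the number of words of length m with lis w < k.  By the first
-- letter, U(m+1,k+1) + b = U(m,k) + U(m,k+1), where b counts the words with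
-- exactly k letters false and lis w ≤ k; the reflection principle gives
-- b = C(m,k) - C(m,k+1).  With n = 2k - m, the alternating sum L(k,n) satisfies
-- the same recurrence L(k+1,n+2) + L(k,n) = L(k+1,n+1) + G(k,n) by Pascal's rule,
-- where G(k,n) = ∑ᵢ (-1)^i C(n-i,i) Cat(k-i); the same method evaluates G(k,n) to
-- the ballot number C(2k-n,k) - C(2k-n,k+1).  Both sides vanish for n = 0 and 1.
module Submission where

open import Defs
open import Data.Bool.Base using (Bool; true; false; T; if_then_else_; _∧_)
open import Data.Bool.Properties using (T-irrelevant)
open import Data.Fin.Base as Fin using (Fin; zero; suc; toℕ; inject₁; inject≤; lift; punchIn)
open import Data.Fin.Permutation using (Permutation′; _⟨$⟩ʳ_; _⟨$⟩ˡ_; _≈_; id; flip; insert; inverseˡ; inverseʳ)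
import Data.Fin.Properties as Fin
open import Data.Integer.Base as ℤ using (ℤ; +_; -1ℤ; 0ℤ)
import Data.Integer.Properties as ℤ
import Data.Integer.Tactic.RingSolver as ℤ-Ring
open import Data.Nat.Base
open import Data.Nat.Combinatorics using (_C_; nC1≡n; nCk≡nC[n∸k]; k>n⇒nCk≡0; nCk+nC[k+1]≡[n+1]C[k+1])
open import Data.Nat.DivMod using (m*n/n≡m)
open import Data.Nat.Properties
open import Data.Nat.Tactic.RingSolver using (solve-∀)
open import Data.Product.Base using (Σ; ∃; _×_; _,_; proj₁; proj₂)
open import Data.Sum.Base using (_⊎_; inj₁; inj₂)
open import Data.Sum.Function.Propositional using (_⊎-↔_)
open import Data.Vec.Base using (Vec; []; _∷_; lookup; tabulate)
open import Data.Vec.Properties using (lookup∘tabulate; tabulate∘lookup; tabulate-cong)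
open import Function.Base using (_∘_)
open import Function.Bundles using (Equivalence; Inverse; _↔_; mk⇔; mk↔ₛ′)
open import Function.Construct.Composition using (_↔-∘_; inverse)
open import Function.Construct.Symmetry using (↔-sym)
open import Relation.Binary.Definitions using (tri<; tri≈; tri>)
open import Relation.Binary.PropositionalEquality using (_≡_; _≢_; refl; sym; trans; cong; cong₂; subst; subst₂; setoid; module ≡-Reasoning)
open import Relation.Nullary.Decidable using (Dec; yes; no; does; _×-dec_; dec-true; dec-false)
open import Relation.Nullary.Negation using (¬_; contradiction)

open import Algebra.Properties.AbelianGroup ℤ.+-0-abelianGroup using () renaming (∙-cancelʳ to ℤ-+-cancelʳ)
open import Algebra.Properties.CommutativeMonoid.Sum ℤ.+-0-commutativeMonoid using (sum-syntax; ∑-distrib-+; sum-cong-≗; sum-replicate-zero)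

private
  variable
    m k l d d′ : ℕ

-- Words and their longest subsequences true … true false … false

Word : ℕ → Set
Word = Vec Bool

zeros : Word m → ℕ
zeros []          = 0
zeros (true ∷ w)  = zeros w
zeros (false ∷ w) = suc (zeros w)

-- After a leading `false` has been chosen only letters `false` may follow, which gives the second
-- argument of `⊔`.
lis : Word m → ℕ
lis []          = 0
lis (true ∷ w)  = suc (lis w)
lis (false ∷ w) = lis w ⊔ suc (zeros w)

zeros≤lis : (w : Word m) → zeros w ≤ lis w
zeros≤lis []          = z≤n
zeros≤lis (true ∷ w)  = m≤n⇒m≤1+n (zeros≤lis w)
zeros≤lis (false ∷ w) = m≤n⊔m (lis w) (suc (zeros w))

-- The letters `true` by themselves form an admissible subsequence, so `lis w` is at least their
-- number. With `zeros≤lis` this makes `lis w` at least half the length.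
length≤lis+zeros : (w : Word m) → m ≤ lis w + zeros w
length≤lis+zeros []          = z≤n
length≤lis+zeros (true ∷ w)  = s≤s (length≤lis+zeros w)
length≤lis+zeros {suc m} (false ∷ w) = begin
  suc m                                       ≤⟨ s≤s (length≤lis+zeros w) ⟩
  suc (lis w + zeros w)                       ≡⟨ +-suc (lis w) (zeros w) ⟨
  lis w + suc (zeros w)                       ≤⟨ +-monoˡ-≤ _ (m≤m⊔n (lis w) _) ⟩
  (lis w ⊔ suc (zeros w)) + suc (zeros w)     ∎
  where open ≤-Reasoning

length≤2lis : (w : Word m) → m ≤ lis w + lis w
length≤2lis w = ≤-trans (length≤lis+zeros w) (+-monoʳ-≤ (lis w) (zeros≤lis w))

-- Counting words by summing indicators

[_] : Bool → ℕ
[ b ] = if b then 1 else 0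

total : (Word m → ℕ) → ℕ
total {zero}  f = f []
total {suc m} f = total (f ∘ (true ∷_)) + total (f ∘ (false ∷_))

total-cong : {f g : Word m → ℕ} → (∀ w → f w ≡ g w) → total f ≡ total g
total-cong {zero}  f≗g = f≗g []
total-cong {suc m} f≗g = cong₂ _+_ (total-cong (f≗g ∘ (true ∷_))) (total-cong (f≗g ∘ (false ∷_)))

total-0 : total {m} (λ _ → 0) ≡ 0
total-0 {zero}  = refl
total-0 {suc m} = cong₂ _+_ (total-0 {m}) (total-0 {m})

total-+ : (f g : Word m → ℕ) → total (λ w → f w + g w) ≡ total f + total g
total-+ {zero}  f g = refl
total-+ {suc m} f g = trans
  (cong₂ _+_ (total-+ (f ∘ (true ∷_)) (g ∘ (true ∷_))) (total-+ (f ∘ (false ∷_)) (g ∘ (false ∷_))))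
  (interchange (total (f ∘ (true ∷_))) _ _ _)
  where
  interchange : ∀ a b c d → (a + b) + (c + d) ≡ (a + c) + (b + d)
  interchange = solve-∀

<⇒<ᵇ≡true : ∀ {a b} → a < b → (a <ᵇ b) ≡ true
<⇒<ᵇ≡true {zero}  {suc b} _         = refl
<⇒<ᵇ≡true {suc a} {suc b} (s≤s a<b) = <⇒<ᵇ≡true a<b

≥⇒<ᵇ≡false : ∀ {a b} → b ≤ a → (a <ᵇ b) ≡ false
≥⇒<ᵇ≡false {a}     {zero}  _         = refl
≥⇒<ᵇ≡false {suc a} {suc b} (s≤s b≤a) = ≥⇒<ᵇ≡false b≤a

≡ᵇ-refl : ∀ a → (a ≡ᵇ a) ≡ true
≡ᵇ-refl zero    = refl
≡ᵇ-refl (suc a) = ≡ᵇ-refl a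

≢⇒≡ᵇ≡false : ∀ {a b} → a ≢ b → (a ≡ᵇ b) ≡ false
≢⇒≡ᵇ≡false {zero}  {zero}  a≢b = contradiction refl a≢b
≢⇒≡ᵇ≡false {zero}  {suc b} a≢b = refl
≢⇒≡ᵇ≡false {suc a} {zero}  a≢b = refl
≢⇒≡ᵇ≡false {suc a} {suc b} a≢b = ≢⇒≡ᵇ≡false (a≢b ∘ cong suc)

-- This is U(m,k) of the opening comment; b is `shortWithZeros m k (suc k)`.
short : (m k : ℕ) → ℕ
short m k = total {m} λ w → [ lis w <ᵇ k ]

shortWithZeros : (m z k : ℕ) → ℕ
shortWithZeros m z k = total {m} λ w → [ (zeros w ≡ᵇ z) ∧ (lis w <ᵇ k) ]

short≡0 : k + k ≤ suc m → short m k ≡ 0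
short≡0 {k} {m} 2k≤1+m = trans (total-cong λ w → cong [_] (≥⇒<ᵇ≡false (k≤lis w))) (total-0 {m})
  where
  k≤lis : (w : Word m) → k ≤ lis w
  k≤lis w with k ≤? lis w
  ... | yes k≤ = k≤
  ... | no  k≰ = contradiction
    (≤-trans (+-mono-≤ (≰⇒> k≰) (≰⇒> k≰)) 2k≤1+m)
    (<⇒≱ (≤-<-trans (s≤s (length≤2lis w)) (≤-reflexive (sym (cong suc (+-suc (lis w) (lis w)))))))

shortWithZeros-k≡0 : ∀ m k → shortWithZeros m k k ≡ 0
shortWithZeros-k≡0 m k = trans (total-cong λ w → cong [_] (helper w)) (total-0 {m})
  where
  helper : (w : Word m) → (zeros w ≡ᵇ k) ∧ (lis w <ᵇ k) ≡ false
  helper w with zeros w ≟ k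
  ... | yes refl rewrite ≡ᵇ-refl (zeros w) = ≥⇒<ᵇ≡false (zeros≤lis w)
  ... | no  z≢k  rewrite ≢⇒≡ᵇ≡false z≢k = refl

-- The reflection principle.
shortWithZeros-closed : ∀ m z k → z ≤ k → m ≤ z + k → shortWithZeros m z k + m C k ≡ m C z
shortWithZeros-closed m z k z≤k m≤z+k with m≤n⇒m<n∨m≡n z≤k
-- The boundary of the reflection: no word qualifies, because `zeros w ≤ lis w`, and the two
-- binomials coincide.
shortWithZeros-closed m z k _ _ | inj₂ refl = cong (_+ m C k) (shortWithZeros-k≡0 m k)
shortWithZeros-closed zero zero    (suc k) _ _ | inj₁ _ = cong suc (k>n⇒nCk≡0 {0} {suc k} z<s)
shortWithZeros-closed zero (suc z) (suc k) _ _ | inj₁ _ = trans (k>n⇒nCk≡0 {0} {suc k} z<s) (sym (k>n⇒nCk≡0 {0} {suc z} z<s))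
-- Only the first letter `true` is possible here, and `m C suc k` vanishes because `m ≤ k`.
shortWithZeros-closed (suc m) zero (suc k) _ 1+m≤1+k | inj₁ _ = begin
  shortWithZeros m 0 k + total {m} (λ _ → 0) + suc m C suc k  ≡⟨ cong₂ (λ a b → shortWithZeros m 0 k + a + b) (total-0 {m}) (sym (nCk+nC[k+1]≡[n+1]C[k+1] m k)) ⟩
  shortWithZeros m 0 k + 0 + (m C k + m C suc k)          ≡⟨ cong (λ a → shortWithZeros m 0 k + 0 + (m C k + a)) (k>n⇒nCk≡0 1+m≤1+k) ⟩
  shortWithZeros m 0 k + 0 + (m C k + 0)                  ≡⟨ cong₂ _+_ (+-identityʳ (shortWithZeros m 0 k)) (+-identityʳ (m C k)) ⟩
  shortWithZeros m 0 k + m C k                            ≡⟨ shortWithZeros-closed m 0 k z≤n (s≤s⁻¹ 1+m≤1+k) ⟩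
  m C 0                                                   ∎
  where open ≡-Reasoning
-- A first letter `true` lowers the bound on `lis` by one, a first letter `false` lowers the number
-- of zeros by one.
shortWithZeros-closed (suc m) (suc z) (suc k) _ 1+m≤ | inj₁ (s≤s 1+z≤k) = begin
  shortWithZeros m (suc z) k + total {m} _ + suc m C suc k
    ≡⟨ cong₂ (λ a b → shortWithZeros m (suc z) k + a + b) (total-cong λ w → cong [_] (drop w)) (sym (nCk+nC[k+1]≡[n+1]C[k+1] m k)) ⟩
  shortWithZeros m (suc z) k + shortWithZeros m z (suc k) + (m C k + m C suc k)
    ≡⟨ interchange (shortWithZeros m (suc z) k) _ _ _ ⟩
  (shortWithZeros m z (suc k) + m C suc k) + (shortWithZeros m (suc z) k + m C k)
    ≡⟨ cong₂ _+_ (shortWithZeros-closed m z (suc k) (≤-trans (n≤1+n z) (m≤n⇒m≤1+n 1+z≤k)) (s≤s⁻¹ 1+m≤))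
                 (shortWithZeros-closed m (suc z) k 1+z≤k (≤-trans (s≤s⁻¹ 1+m≤) (≤-reflexive (+-suc z k)))) ⟩
  m C z + m C suc z
    ≡⟨ nCk+nC[k+1]≡[n+1]C[k+1] m z ⟩
  suc m C suc z ∎
  where
  open ≡-Reasoning
  interchange : ∀ a b c d → (a + b) + (c + d) ≡ (b + d) + (a + c)
  interchange = solve-∀
  -- When `zeros w` is `z`, the second argument of `⊔` is `suc z ≤ k`, so `lis w` alone decides the
  -- comparison.
  drop : (w : Word m) → (zeros w ≡ᵇ z) ∧ (lis w ⊔ suc (zeros w) <ᵇ suc k) ≡ (zeros w ≡ᵇ z) ∧ (lis w <ᵇ suc k)
  drop w with zeros w ≟ z
  ... | no  z≢ rewrite ≢⇒≡ᵇ≡false z≢ = refl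
  ... | yes refl rewrite ≡ᵇ-refl (zeros w) with lis w <? suc k
  ...   | yes l< = trans (<⇒<ᵇ≡true (⊔-pres-<m l< (s≤s 1+z≤k))) (sym (<⇒<ᵇ≡true l<))
  ...   | no  l≮ = trans (≥⇒<ᵇ≡false (≤-trans (≮⇒≥ l≮) (m≤m⊔n _ _))) (sym (≥⇒<ᵇ≡false (≮⇒≥ l≮)))

-- Conditioning on the first letter: among the words w of length m with
-- lis w ≤ k, prepending false raises lis above k exactly when zeros w ≡ k.
short-rec : ∀ m k → short (suc m) (suc k) + shortWithZeros m k (suc k) ≡ short m k + short m (suc k)
short-rec m k = trans (+-assoc (short m k) _ _) (cong (_+_ (short m k))
  (trans (sym (total-+ {m} _ _)) (total-cong split)))
  where
  split : (w : Word m) → [ lis w ⊔ suc (zeros w) <ᵇ suc k ] + [ (zeros w ≡ᵇ k) ∧ (lis w <ᵇ suc k) ] ≡ [ lis w <ᵇ suc k ]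
  split w with lis w <? suc k
  ... | no l≮ rewrite ≥⇒<ᵇ≡false (≮⇒≥ l≮) | ≥⇒<ᵇ≡false (≤-trans (≮⇒≥ l≮) (m≤m⊔n (lis w) (suc (zeros w)))) with zeros w ≡ᵇ k
  ...   | true  = refl
  ...   | false = refl
  split w | yes l< with zeros w ≟ k
  ... | yes refl rewrite ≡ᵇ-refl (zeros w) | ≥⇒<ᵇ≡false (m≤n⊔m (lis w) (suc (zeros w))) = refl
  ... | no  z≢k  rewrite ≢⇒≡ᵇ≡false z≢k | <⇒<ᵇ≡true l<
                       | <⇒<ᵇ≡true (⊔-pres-<m l< (s≤s (≤∧≢⇒< (≤-trans (zeros≤lis w) (s≤s⁻¹ l<)) z≢k))) = refl

-- Binomial coefficients and Catalan numbers

-- The absorption identity, by induction on `n`: Pascal's rule splits the left side and, after the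
-- induction hypotheses, reassembles the right.
[1+k]*[1+n]C[1+k]≡[1+n]*nCk : ∀ n k → suc k * (suc n C suc k) ≡ suc n * (n C k)
[1+k]*[1+n]C[1+k]≡[1+n]*nCk zero    zero    = refl
[1+k]*[1+n]C[1+k]≡[1+n]*nCk zero    (suc k)
  rewrite k>n⇒nCk≡0 {1} {2 + k} (s≤s z<s) | k>n⇒nCk≡0 {0} {suc k} z<s = *-zeroʳ k
[1+k]*[1+n]C[1+k]≡[1+n]*nCk (suc n) zero
  rewrite nC1≡n (2 + n) = trans (+-identityʳ (2 + n)) (sym (*-identityʳ (2 + n)))
[1+k]*[1+n]C[1+k]≡[1+n]*nCk (suc n) (suc k) = begin
  (2 + k) * ((2 + n) C (2 + k))
    ≡⟨ cong ((2 + k) *_) (nCk+nC[k+1]≡[n+1]C[k+1] (suc n) (suc k)) ⟨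
  (2 + k) * (suc n C suc k + suc n C (2 + k))
    ≡⟨ regroup k (suc n C suc k) _ ⟩
  suc n C suc k + (suc k * (suc n C suc k) + (2 + k) * (suc n C (2 + k)))
    ≡⟨ cong (_+_ (suc n C suc k)) (cong₂ _+_ ([1+k]*[1+n]C[1+k]≡[1+n]*nCk n k) ([1+k]*[1+n]C[1+k]≡[1+n]*nCk n (suc k))) ⟩
  suc n C suc k + (suc n * (n C k) + suc n * (n C suc k))
    ≡⟨ cong (_+_ (suc n C suc k)) (*-distribˡ-+ (suc n) (n C k) (n C suc k)) ⟨
  suc n C suc k + suc n * (n C k + n C suc k)
    ≡⟨ cong (λ c → suc n C suc k + suc n * c) (nCk+nC[k+1]≡[n+1]C[k+1] n k) ⟩
  (2 + n) * (suc n C suc k) ∎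
  where
  open ≡-Reasoning
  regroup : ∀ k a b → (2 + k) * (a + b) ≡ a + (suc k * a + (2 + k) * b)
  regroup = solve-∀

-- With x and y the binomials C(2n,n) and C(2n,n+1), absorption gives (n+1)y = nx. Hence t = x - y
-- satisfies x = t(n+1), so the division is exact and its quotient is t.
catalan-diff : ∀ n → catalan n + (2 * n) C suc n ≡ (2 * n) C n
catalan-diff n = begin
  x / suc n + y            ≡⟨ cong (λ a → a / suc n + y) x≡t*[1+n] ⟩
  (t * suc n) / suc n + y  ≡⟨ cong (_+ y) (m*n/n≡m t (suc n)) ⟩
  t + y                    ≡⟨ m∸n+n≡m y≤x ⟩
  x                        ∎
  where
  open ≡-Reasoning
  x = (2 * n) C n
  y = (2 * n) C suc n
  t = x ∸ y
  [1+n]y≡nx : suc n * y ≡ n * x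
  -- Adding `suc n * x` completes the Pascal sum `x + y`, to which absorption applies.
  [1+n]y≡nx = +-cancelˡ-≡ (suc n * x) _ _ (begin
    suc n * x + suc n * y             ≡⟨ *-distribˡ-+ (suc n) x y ⟨
    suc n * (x + y)                   ≡⟨ cong (suc n *_) (nCk+nC[k+1]≡[n+1]C[k+1] (2 * n) n) ⟩
    suc n * (suc (2 * n) C suc n)     ≡⟨ [1+k]*[1+n]C[1+k]≡[1+n]*nCk (2 * n) n ⟩
    suc (2 * n) * x                   ≡⟨ double n x ⟩
    suc n * x + n * x                 ∎)
    where
    double : ∀ n x → suc (2 * n) * x ≡ suc n * x + n * x
    double = solve-∀
  y≤x : y ≤ x
  y≤x = *-cancelˡ-≤ (suc n) (≤-trans (≤-reflexive [1+n]y≡nx) (*-monoˡ-≤ x (n≤1+n n)))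
  y≡nt : y ≡ n * t
  y≡nt = +-cancelʳ-≡ (n * y) _ _ (begin
    y + n * y        ≡⟨ [1+n]y≡nx ⟩
    n * x            ≡⟨ cong (n *_) (m∸n+n≡m y≤x) ⟨
    n * (t + y)      ≡⟨ *-distribˡ-+ n t y ⟩
    n * t + n * y    ∎)
  x≡t*[1+n] : x ≡ t * suc n
  x≡t*[1+n] = begin
    x          ≡⟨ m∸n+n≡m y≤x ⟨
    t + y      ≡⟨ cong (_+_ t) y≡nt ⟩
    suc n * t  ≡⟨ *-comm (suc n) t ⟩
    t * suc n  ∎

-- The alternating sums

∑< : ℕ → (ℕ → ℤ) → ℤ
∑< N f = ∑[ i < N ] f (toℕ i)

∑<-cong : ∀ N {f g : ℕ → ℤ} → (∀ i → f i ≡ g i) → ∑< N f ≡ ∑< N g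
∑<-cong N f≗g = sum-cong-≗ {N} (f≗g ∘ toℕ)

∑<-+ : ∀ N (f g : ℕ → ℤ) → ∑< N (λ i → f i ℤ.+ g i) ≡ ∑< N f ℤ.+ ∑< N g
∑<-+ N f g = ∑-distrib-+ {N} (f ∘ toℕ) (g ∘ toℕ)

∑<-zero : ∀ N {f : ℕ → ℤ} → (∀ i → f i ≡ 0ℤ) → ∑< N f ≡ 0ℤ
∑<-zero N f≗0 = trans (∑<-cong N f≗0) (sum-replicate-zero N)

ballotTerm : ℕ → ℕ → ℕ → ℤ
ballotTerm k n i = (-1ℤ ℤ.^ i) ℤ.* + (((n ∸ i) C i) * catalan (k ∸ i))

-- The ballot terms with weight `j`. Up to sign and a shift of the index they are the main terms,
-- which is what closes the recurrence.
weightedTerm : ℕ → ℕ → ℕ → ℤ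
weightedTerm k n j = (-1ℤ ℤ.^ j) ℤ.* + (j * ((n ∸ j) C j) * catalan (k ∸ j))

-- This is summand k m (suc i) with 2 * k ∸ m abstracted to n.
mainTerm : ℕ → ℕ → ℕ → ℤ
mainTerm k n i = (-1ℤ ℤ.^ i) ℤ.* + (suc i * ((n ∸ suc i) C suc i) * catalan (k ∸ suc i))

-- For `i` beyond `n` the differences truncate to 0 while the lower entries are positive, so all
-- three binomials vanish. The sums can therefore be compared term by term over any range.
pascal-∸ : ∀ n i → (suc n ∸ i) C suc i ≡ (n ∸ i) C i + (n ∸ i) C suc i
pascal-∸ n i with i ≤? n
... | yes i≤n rewrite +-∸-assoc 1 i≤n = sym (nCk+nC[k+1]≡[n+1]C[k+1] (n ∸ i) i)
... | no  i≰n with s≤s {m = i′} n≤i′ ← ≰⇒> i≰n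
  rewrite m≤n⇒m∸n≡0 (m≤n⇒m≤1+n n≤i′) | m≤n⇒m∸n≡0 n≤i′
        | k>n⇒nCk≡0 {0} {suc i′} z<s | k>n⇒nCk≡0 {0} {2 + i′} z<s = refl

-- The shift of the index flips the sign, so the Pascal summand with lower entry `i` cancels and the
-- one with `suc i` remains.
ballotTerm-suc : ∀ k n i → ballotTerm (suc k) (2 + n) (suc i) ℤ.+ ballotTerm k n i ≡ ballotTerm (suc k) (suc n) (suc i)
ballotTerm-suc k n i
  rewrite pascal-∸ n i | *-distribʳ-+ (catalan (k ∸ i)) ((n ∸ i) C i) ((n ∸ i) C suc i)
        | ℤ.pos-+ (((n ∸ i) C i) * catalan (k ∸ i)) (((n ∸ i) C suc i) * catalan (k ∸ i))
        | ℤ.-1*i≡-i (-1ℤ ℤ.^ i)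
        = cancel (-1ℤ ℤ.^ i) _ _
  where
  cancel : ∀ s a b → ℤ.- s ℤ.* (a ℤ.+ b) ℤ.+ s ℤ.* a ≡ ℤ.- s ℤ.* b
  cancel = ℤ-Ring.solve-∀

-- In the Pascal summand with lower entry `i` the weight `suc i` is read as 1 + i: the 1 yields the
-- ballot term, the `i` the weighted term.
mainTerm-suc : ∀ k n i → mainTerm (suc k) (2 + n) i ≡ mainTerm (suc k) (suc n) i ℤ.+ (ballotTerm k n i ℤ.+ weightedTerm k n i)
mainTerm-suc k n i = begin
  s ℤ.* + (suc i * ((suc n ∸ i) C suc i) * c)      ≡⟨ cong (λ x → s ℤ.* + (suc i * x * c)) (pascal-∸ n i) ⟩
  s ℤ.* + (suc i * (a + b) * c)                    ≡⟨ cong (λ x → s ℤ.* + x) (expand i a b c) ⟩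
  s ℤ.* (+ (suc i * b * c + (a * c + i * a * c)))  ≡⟨ ℤ.*-distribˡ-+ s (+ (suc i * b * c)) (+ (a * c + i * a * c)) ⟩
  s ℤ.* + (suc i * b * c) ℤ.+ s ℤ.* + (a * c + i * a * c)  ≡⟨ cong (ℤ._+_ (s ℤ.* + (suc i * b * c))) (ℤ.*-distribˡ-+ s (+ (a * c)) (+ (i * a * c))) ⟩
  s ℤ.* + (suc i * b * c) ℤ.+ (s ℤ.* + (a * c) ℤ.+ s ℤ.* + (i * a * c)) ∎
  where
  open ≡-Reasoning
  s = -1ℤ ℤ.^ i
  a = (n ∸ i) C i
  b = (n ∸ i) C suc i
  c = catalan (k ∸ i)
  expand : ∀ i a b c → suc i * (a + b) * c ≡ suc i * b * c + (a * c + i * a * c)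
  expand = solve-∀

weightedTerm-suc : ∀ k n i → weightedTerm k n (suc i) ℤ.+ mainTerm k n i ≡ 0ℤ
weightedTerm-suc k n i rewrite ℤ.-1*i≡-i (-1ℤ ℤ.^ i) = cancel (-1ℤ ℤ.^ i) _
  where
  cancel : ∀ s a → ℤ.- s ℤ.* a ℤ.+ s ℤ.* a ≡ 0ℤ
  cancel = ℤ-Ring.solve-∀

-- The terms at index 0 agree, both binomials having lower entry 0. The remaining terms are shifted
-- by one, hence the ranges `suc N` and `N`.
ballotSum-rec : ∀ N k n → ∑< (suc N) (ballotTerm (suc k) (2 + n)) ℤ.+ ∑< N (ballotTerm k n) ≡ ∑< (suc N) (ballotTerm (suc k) (suc n))
ballotSum-rec N k n = begin
  b₀ ℤ.+ ∑< N (ballotTerm (suc k) (2 + n) ∘ suc) ℤ.+ ∑< N (ballotTerm k n)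
    ≡⟨ ℤ.+-assoc b₀ (∑< N (ballotTerm (suc k) (2 + n) ∘ suc)) _ ⟩
  b₀ ℤ.+ (∑< N (ballotTerm (suc k) (2 + n) ∘ suc) ℤ.+ ∑< N (ballotTerm k n))
    ≡⟨ cong (ℤ._+_ b₀) (∑<-+ N (ballotTerm (suc k) (2 + n) ∘ suc) (ballotTerm k n)) ⟨
  b₀ ℤ.+ ∑< N (λ i → ballotTerm (suc k) (2 + n) (suc i) ℤ.+ ballotTerm k n i)
    ≡⟨ cong (ℤ._+_ b₀) (∑<-cong N (ballotTerm-suc k n)) ⟩
  b₀ ℤ.+ ∑< N (ballotTerm (suc k) (suc n) ∘ suc) ∎
  where
  open ≡-Reasoning
  b₀ = ballotTerm (suc k) (2 + n) 0

-- Shifted by one, the weighted part of `mainTerm-suc` cancels the sum of `mainTerm k n`, leaving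
-- only the ballot part.
mainSum-rec : ∀ N k n → ∑< (suc N) (mainTerm (suc k) (2 + n)) ℤ.+ ∑< N (mainTerm k n)
                      ≡ ∑< (suc N) (mainTerm (suc k) (suc n)) ℤ.+ ∑< (suc N) (ballotTerm k n)
mainSum-rec N k n = begin
  ∑< (suc N) (mainTerm (suc k) (2 + n)) ℤ.+ M
    ≡⟨ cong (ℤ._+ M) (∑<-cong (suc N) (mainTerm-suc k n)) ⟩
  ∑< (suc N) (λ i → mainTerm (suc k) (suc n) i ℤ.+ (ballotTerm k n i ℤ.+ weightedTerm k n i)) ℤ.+ M
    ≡⟨ cong (ℤ._+ M) (trans (∑<-+ (suc N) (mainTerm (suc k) (suc n)) (λ i → ballotTerm k n i ℤ.+ weightedTerm k n i))
                            (cong (ℤ._+_ A) (∑<-+ (suc N) (ballotTerm k n) (weightedTerm k n)))) ⟩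
  -- The `0ℤ` is the weighted term at index 0.
  A ℤ.+ (B ℤ.+ (0ℤ ℤ.+ W)) ℤ.+ M
    ≡⟨ regroup A B W M ⟩
  A ℤ.+ B ℤ.+ (W ℤ.+ M)
    ≡⟨ cong (ℤ._+_ (A ℤ.+ B)) (trans (sym (∑<-+ N (weightedTerm k n ∘ suc) (mainTerm k n))) (∑<-zero N (weightedTerm-suc k n))) ⟩
  A ℤ.+ B ℤ.+ 0ℤ
    ≡⟨ ℤ.+-identityʳ (A ℤ.+ B) ⟩
  A ℤ.+ B ∎
  where
  open ≡-Reasoning
  M = ∑< N (mainTerm k n)
  A = ∑< (suc N) (mainTerm (suc k) (suc n))
  B = ∑< (suc N) (ballotTerm k n)
  W = ∑< N (weightedTerm k n ∘ suc)
  regroup : ∀ A B W M → A ℤ.+ (B ℤ.+ (0ℤ ℤ.+ W)) ℤ.+ M ≡ A ℤ.+ B ℤ.+ (W ℤ.+ M)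
  regroup = ℤ-Ring.solve-∀

-- Closed forms of the alternating sums

ballotTerm≡0 : ∀ k n i → n ≤ 1 → ballotTerm k n (suc i) ≡ 0ℤ
ballotTerm≡0 k n i n≤1 rewrite m≤n⇒m∸n≡0 (≤-trans n≤1 (s≤s (z≤n {i}))) | k>n⇒nCk≡0 {0} {suc i} z<s = ℤ.*-zeroʳ (-1ℤ ℤ.^ suc i)

mainTerm≡0 : ∀ k n i → n ≤ 1 → mainTerm k n i ≡ 0ℤ
mainTerm≡0 k n i n≤1 rewrite m≤n⇒m∸n≡0 (≤-trans n≤1 (s≤s (z≤n {i}))) | k>n⇒nCk≡0 {0} {suc i} z<s | *-zeroʳ i = ℤ.*-zeroʳ (-1ℤ ℤ.^ i)

ballotSum-head : ∀ N k n → (∀ i → ballotTerm k n (suc i) ≡ 0ℤ) → ∑< (suc N) (ballotTerm k n) ≡ + catalan k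
ballotSum-head N k n tail≡0 = trans
  (cong₂ ℤ._+_ (trans (ℤ.*-identityˡ _) (cong +_ (*-identityˡ (catalan k)))) (∑<-zero N tail≡0))
  (ℤ.+-identityʳ _)

-- The case n = 1 of the ballot evaluation. Pascal's rule carries `catalan-diff` from row 2n + 2 to
-- row 2n + 1, whose two middle entries are equal.
catalan-diff-odd : ∀ n → catalan (suc n) + (suc (n + n)) C (2 + n) ≡ (suc (n + n)) C suc n
catalan-diff-odd n = +-cancelʳ-≡ (suc (n + n) C suc n) _ _ (begin
  catalan (suc n) + r C (2 + n) + r C suc n     ≡⟨ regroup (catalan (suc n)) _ _ ⟩
  catalan (suc n) + (r C suc n + r C (2 + n))   ≡⟨ cong (_+_ (catalan (suc n))) (nCk+nC[k+1]≡[n+1]C[k+1] r (suc n)) ⟩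
  catalan (suc n) + suc r C (2 + n)             ≡⟨ cong (λ q → catalan (suc n) + q C (2 + n)) (even n) ⟨
  catalan (suc n) + (2 * suc n) C (2 + n)       ≡⟨ catalan-diff (suc n) ⟩
  (2 * suc n) C suc n                           ≡⟨ cong (_C suc n) (even n) ⟩
  suc r C suc n                                 ≡⟨ nCk+nC[k+1]≡[n+1]C[k+1] r n ⟨
  r C n + r C suc n                             ≡⟨ cong (_+ r C suc n) sym-middle ⟩
  r C suc n + r C suc n                         ∎)
  where
  open ≡-Reasoning
  r = suc (n + n)
  regroup : ∀ a b c → a + b + c ≡ a + (c + b)
  regroup = solve-∀
  even : ∀ n → 2 * suc n ≡ 2 + (n + n)
  even = solve-∀
  sym-middle : r C n ≡ r C suc n
  sym-middle = trans (nCk≡nC[n∸k] (m≤n⇒m≤1+n (m≤m+n n n)))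
    (cong (r C_) (trans (+-∸-assoc 1 (m≤m+n n n)) (cong suc (m+n∸m≡n n n))))

-- Instantiated at k = n + e and t = 2k - n = n + 2e, which avoids subtraction.
BallotClosed : (n k t N : ℕ) → Set
BallotClosed n k t N = ∑< N (ballotTerm k n) ℤ.+ + (t C suc k) ≡ + (t C k)

n+2[1+e]≡2+[n+2e] : ∀ n e → n + (suc e + suc e) ≡ 2 + (n + (e + e))
n+2[1+e]≡2+[n+2e] = solve-∀

-- By `ballotSum-rec` the new sum is `Z` minus `Y`, and by Pascal's rule the ballot numbers subtract
-- in the same way. Adding `Y` and `q` to both sides replaces the subtractions.
ballotSum-closed-step : ∀ n e N →
  BallotClosed n (suc (n + e)) (2 + (n + (e + e))) N →
  BallotClosed (suc n) (2 + (n + e)) (3 + (n + (e + e))) (suc N) →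
  BallotClosed (2 + n) (2 + (n + e)) (2 + (n + (e + e))) (suc N)
ballotSum-closed-step n e N ihₙ ihₙ₊₁ = ℤ-+-cancelʳ Y _ _ (ℤ-+-cancelʳ (+ q) _ _ (begin
    X ℤ.+ + r ℤ.+ Y ℤ.+ + q           ≡⟨ shuffle X (+ r) Y (+ q) ⟩
    (X ℤ.+ Y) ℤ.+ (+ q ℤ.+ + r)           ≡⟨ cong₂ ℤ._+_ (ballotSum-rec N k′ n) (trans (sym (ℤ.pos-+ q r)) (cong +_ (nCk+nC[k+1]≡[n+1]C[k+1] t (suc k′)))) ⟩
    Z ℤ.+ + (suc t C (2 + k′))            ≡⟨ ihₙ₊₁ ⟩
    + (suc t C suc k′)                    ≡⟨ cong +_ (nCk+nC[k+1]≡[n+1]C[k+1] t k′) ⟨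
    + (p + q)                             ≡⟨ trans (cong +_ (+-comm p q)) (ℤ.pos-+ q p) ⟩
    + q ℤ.+ + p                           ≡⟨ cong (ℤ._+_ (+ q)) ihₙ ⟨
    + q ℤ.+ (Y ℤ.+ + q)                   ≡⟨ ℤ.+-assoc (+ q) Y (+ q) ⟨
    + q ℤ.+ Y ℤ.+ + q                     ∎))
  where
  open ≡-Reasoning
  k′ = suc (n + e)
  t = 2 + (n + (e + e))
  r = t C (2 + k′)
  q = t C suc k′
  p = t C k′
  X = ∑< (suc N) (ballotTerm (suc k′) (2 + n))
  Y = ∑< N (ballotTerm k′ n)
  Z = ∑< (suc N) (ballotTerm (suc k′) (suc n))
  shuffle : ∀ X r Y q → X ℤ.+ r ℤ.+ Y ℤ.+ q ≡ (X ℤ.+ Y) ℤ.+ (q ℤ.+ r)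
  shuffle = ℤ-Ring.solve-∀

-- Lowering `n` by 2 and k by 1, or `n` alone by 1, raises `e` by 1, so the induction on `n` keeps
-- `e` and `N` general. Terms beyond index `n` vanish, so every `N` above `n` serves.
ballotSum-closed : ∀ n e N → n < N → BallotClosed n (n + e) (n + (e + e)) N
ballotSum-closed 0 e (suc N) _ = trans
  (cong (ℤ._+ + ((e + e) C suc e)) (ballotSum-head N e 0 (λ i → ballotTerm≡0 e 0 i z≤n)))
  (cong +_ (subst (λ q → catalan e + q C suc e ≡ q C e) (cong (_+_ e) (+-identityʳ e)) (catalan-diff e)))
ballotSum-closed 1 e (suc N) _ = trans
  (cong (ℤ._+ + (suc (e + e) C (2 + e))) (ballotSum-head N (suc e) 1 (λ i → ballotTerm≡0 (suc e) 1 i ≤-refl)))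
  (cong +_ (catalan-diff-odd e))
ballotSum-closed (suc (suc n)) e (suc N) (s≤s 2+n≤N) = ballotSum-closed-step n e N
  (subst₂ (λ k t → BallotClosed n k t N) (+-suc n e) (n+2[1+e]≡2+[n+2e] n e)
    (ballotSum-closed n (suc e) N (≤-trans (n≤1+n (suc n)) 2+n≤N)))
  (subst₂ (λ k t → BallotClosed (suc n) (suc k) (suc t) (suc N)) (+-suc n e) (n+2[1+e]≡2+[n+2e] n e)
    (ballotSum-closed (suc n) (suc e) (suc N) (m≤n⇒m≤1+n 2+n≤N)))

MainClosed : (n k t N : ℕ) → Set
MainClosed n k t N = ∑< N (mainTerm k n) ≡ + short t k

-- `mainSum-rec` and `short-rec` are the same recurrence once `B` is matched with the count in
-- `short-rec`: each of the two, added to `t C suc k′`, gives `t C k′`.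
mainSum-closed-step : ∀ n e N → n ≤ N →
  MainClosed n (suc (n + e)) (2 + (n + (e + e))) N →
  MainClosed (suc n) (2 + (n + e)) (3 + (n + (e + e))) (suc N) →
  MainClosed (2 + n) (2 + (n + e)) (2 + (n + (e + e))) (suc N)
mainSum-closed-step n e N n≤N ihₙ ihₙ₊₁ = ℤ-+-cancelʳ (+ short t k′) _ _ (begin
    X ℤ.+ + short t k′                                      ≡⟨ cong (ℤ._+_ X) ihₙ ⟨
    X ℤ.+ Y                                                 ≡⟨ mainSum-rec N k′ n ⟩
    Z ℤ.+ B                                                 ≡⟨ cong₂ ℤ._+_ ihₙ₊₁ B≡ ⟩
    + short (suc t) (suc k′) ℤ.+ + shortWithZeros t k′ (suc k′)  ≡⟨ ℤ.pos-+ (short (suc t) (suc k′)) _ ⟨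
    + (short (suc t) (suc k′) + shortWithZeros t k′ (suc k′))    ≡⟨ cong +_ (trans (short-rec t k′) (+-comm (short t k′) _)) ⟩
    + (short t (suc k′) + short t k′)                       ≡⟨ ℤ.pos-+ (short t (suc k′)) _ ⟩
    + short t (suc k′) ℤ.+ + short t k′                     ∎)
  where
  open ≡-Reasoning
  k′ = suc (n + e)
  t = 2 + (n + (e + e))
  X = ∑< (suc N) (mainTerm (suc k′) (2 + n))
  Y = ∑< N (mainTerm k′ n)
  Z = ∑< (suc N) (mainTerm (suc k′) (suc n))
  B = ∑< (suc N) (ballotTerm k′ n)
  -- Since t = 2k′ - n, the reflection principle applies with `suc n` to spare.
  t≤ : t ≤ k′ + suc k′
  t≤ = ≤-trans (m≤n+m t (suc n)) (≤-reflexive (slack n e))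
    where
    slack : ∀ n e → suc n + (2 + (n + (e + e))) ≡ suc (n + e) + (2 + (n + e))
    slack = solve-∀
  B≡ : B ≡ + shortWithZeros t k′ (suc k′)
  B≡ = ℤ-+-cancelʳ (+ (t C suc k′)) _ _ (trans ballot
    (trans (cong +_ (sym (shortWithZeros-closed t k′ (suc k′) (n≤1+n k′) t≤))) (ℤ.pos-+ (shortWithZeros t k′ (suc k′)) _)))
    where
    ballot : B ℤ.+ + (t C suc k′) ≡ + (t C k′)
    ballot = subst₂ (λ k t → BallotClosed n k t (suc N)) (+-suc n e) (n+2[1+e]≡2+[n+2e] n e)
      (ballotSum-closed n (suc e) (suc N) (s≤s n≤N))

-- Index `i` stands for j = i + 1, so `n` terms already contain every nonzero one. In the base cases
-- 2k is at most t + 1, with equality for n = 1, and no word is short.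
mainSum-closed : ∀ n e N → n ≤ N → MainClosed n (n + e) (n + (e + e)) N
mainSum-closed 0 e N _ = trans (∑<-zero N (λ i → mainTerm≡0 e 0 i z≤n)) (cong +_ (sym (short≡0 {e} (n≤1+n (e + e)))))
mainSum-closed 1 e N _ = trans (∑<-zero N (λ i → mainTerm≡0 (suc e) 1 i ≤-refl))
  (cong +_ (sym (short≡0 {suc e} (≤-reflexive (cong suc (+-suc e e))))))
mainSum-closed (suc (suc n)) e (suc N) (s≤s 1+n≤N) = mainSum-closed-step n e N n≤N
  (subst₂ (λ k t → MainClosed n k t N) (+-suc n e) (n+2[1+e]≡2+[n+2e] n e)
    (mainSum-closed n (suc e) N n≤N))
  (subst₂ (λ k t → MainClosed (suc n) (suc k) (suc t) (suc N)) (+-suc n e) (n+2[1+e]≡2+[n+2e] n e)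
    (mainSum-closed (suc n) (suc e) (suc N) (m≤n⇒m≤1+n 1+n≤N)))
  where
  n≤N = ≤-trans (n≤1+n n) 1+n≤N

-- Increasing subsequences

StrictlyMonotone : (Fin k → Fin m) → Set
StrictlyMonotone f = ∀ {i j} → i Fin.< j → f i Fin.< f j

-- Applied to an order automorphism and to its inverse, this forces the identity in `split-≈`.
strictlyMonotone⇒inflationary : (f : Fin k → Fin m) → StrictlyMonotone f → ∀ i → i Fin.≤ f i
strictlyMonotone⇒inflationary f f-mono zero    = z≤n
strictlyMonotone⇒inflationary f f-mono (suc i) = ≤-<-trans
  (strictlyMonotone⇒inflationary (f ∘ inject₁) (f-mono ∘ inject₁-mono-<) i)
  (f-mono (s≤s (≤-reflexive (Fin.toℕ-inject₁ i))))
  where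
  inject₁-mono-< : ∀ {n} {i j : Fin n} → i Fin.< j → inject₁ i Fin.< inject₁ j
  inject₁-mono-< {i = i} {j} = subst₂ _<_ (sym (Fin.toℕ-inject₁ i)) (sym (Fin.toℕ-inject₁ j))

inject≤-strictlyMonotone : (k≤m : k ≤ m) → StrictlyMonotone (λ i → inject≤ i k≤m)
inject≤-strictlyMonotone k≤m {i} {j} = subst₂ _<_ (sym (Fin.toℕ-inject≤ i k≤m)) (sym (Fin.toℕ-inject≤ j k≤m))

lift-strictlyMonotone : {f : Fin k → Fin m} → StrictlyMonotone f → StrictlyMonotone (lift 1 f)
lift-strictlyMonotone f-mono {zero}  {suc j} _         = z<s
lift-strictlyMonotone f-mono {suc i} {suc j} (s≤s i<j) = s≤s (f-mono i<j)

increasing⇒contains-id : (σ : Permutation′ m) (ι : Fin k → Fin m) → StrictlyMonotone ι →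
                         StrictlyMonotone (λ i → σ ⟨$⟩ʳ ι i) → Contains σ (id {k})
increasing⇒contains-id σ ι ι-mono σι-mono = ι , (λ _ _ → ι-mono) , λ i j → mk⇔ σι-mono (reflect i j)
  where
  reflect : ∀ i j → (σ ⟨$⟩ʳ ι i) Fin.< (σ ⟨$⟩ʳ ι j) → i Fin.< j
  reflect i j σιi<σιj with Fin.<-cmp i j
  ... | tri< i<j _ _ = i<j
  ... | tri≈ _ refl _ = contradiction σιi<σιj (<-irrefl refl)
  ... | tri> _ _ j<i = contradiction σιi<σιj (<-asym (σι-mono j<i))

-- `trueFirst` forbids a letter `true` after a letter `false`, so the selected letters read true ...
-- true false ... false. The indices are places in the word, hence values of the permutation.
record Chain (w : Word m) (k : ℕ) : Set where
  constructor chain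
  field
    index     : Fin k → Fin m
    monotone  : StrictlyMonotone index
    trueFirst : ∀ {i j} → i Fin.< j → lookup w (index j) ≡ true → lookup w (index i) ≡ true

positive⇒suc : (x : Fin (suc m)) → 0 < toℕ x → ∃ λ y → x ≡ suc y
positive⇒suc (suc y) _ = y , refl

lower : (κ : Fin k → Fin (suc m)) → StrictlyMonotone κ → (∀ i → 0 < toℕ (κ i)) →
        Σ (Fin k → Fin m) λ κ′ → StrictlyMonotone κ′ × (∀ i → κ i ≡ suc (κ′ i))
lower κ κ-mono κ>0 = κ′ , (λ {i} {j} i<j → s≤s⁻¹ (subst₂ Fin._<_ (κ≡ i) (κ≡ j) (κ-mono i<j))) , κ≡
  where
  κ′ = λ i → proj₁ (positive⇒suc (κ i) (κ>0 i))
  κ≡ = λ i → proj₂ (positive⇒suc (κ i) (κ>0 i))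

head-positive : (κ : Fin (suc k) → Fin (suc m)) → StrictlyMonotone κ → 0 < toℕ (κ zero) → ∀ i → 0 < toℕ (κ i)
head-positive κ κ-mono κ₀>0 zero    = κ₀>0
head-positive κ κ-mono κ₀>0 (suc i) = <-trans κ₀>0 (κ-mono z<s)

tail-positive : (κ : Fin (suc k) → Fin (suc m)) → StrictlyMonotone κ → ∀ i → 0 < toℕ (κ (suc i))
tail-positive κ κ-mono i = ≤-<-trans z≤n (κ-mono {zero} {suc i} z<s)

falses≤zeros : (w : Word m) (κ : Fin k → Fin m) → StrictlyMonotone κ → (∀ i → lookup w (κ i) ≡ false) → k ≤ zeros w
falses≤zeros {k = zero} w κ κ-mono κ-false = z≤n
falses≤zeros {k = suc k} [] κ κ-mono κ-false = contradiction (κ zero) λ ()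
falses≤zeros {k = suc k} (b ∷ w) κ κ-mono κ-false with κ zero in κ₀≡
... | suc x = ≤-trans (falses≤zeros w κ′ κ′-mono λ i → trans (cong (lookup (b ∷ w)) (sym (κ≡ i))) (κ-false i)) (zeros-∷ b)
  where
  lowered = lower κ κ-mono (head-positive κ κ-mono (subst (λ y → 0 < toℕ y) (sym κ₀≡) z<s))
  κ′ = proj₁ lowered
  κ′-mono = proj₁ (proj₂ lowered)
  κ≡ = proj₂ (proj₂ lowered)
  zeros-∷ : ∀ b → zeros w ≤ zeros (b ∷ w)
  zeros-∷ true  = ≤-refl
  zeros-∷ false = n≤1+n _
... | zero with trans (cong (lookup (b ∷ w)) (sym κ₀≡)) (κ-false zero)
...   | refl = s≤s (falses≤zeros w κ′ κ′-mono λ i → trans (cong (lookup (b ∷ w)) (sym (κ≡ i))) (κ-false (suc i)))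
  where
  lowered = lower (κ ∘ suc) (κ-mono ∘ s≤s) (tail-positive κ κ-mono)
  κ′ = proj₁ lowered
  κ′-mono = proj₁ (proj₂ lowered)
  κ≡ = proj₂ (proj₂ lowered)

-- The cases follow `lis`: a chain missing place 0 lies in the tail, one starting there with `true`
-- loses one entry, and one starting there with `false` continues with letters `false` only.
chain⇒≤lis : (w : Word m) → Chain w k → k ≤ lis w
chain⇒≤lis {k = zero} w _ = z≤n
chain⇒≤lis {k = suc k} [] (chain κ _ _) = contradiction (κ zero) λ ()
chain⇒≤lis {k = suc k} (b ∷ w) (chain κ κ-mono κ-tf) with κ zero in κ₀≡
... | suc x = ≤-trans (chain⇒≤lis w (chain κ′ κ′-mono λ {i} {j} i<j →
      trans (cong (lookup (b ∷ w)) (sym (κ≡ i))) ∘ κ-tf i<j ∘ trans (cong (lookup (b ∷ w)) (κ≡ j)))) (lis-∷ b)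
  where
  lowered = lower κ κ-mono (head-positive κ κ-mono (subst (λ y → 0 < toℕ y) (sym κ₀≡) z<s))
  κ′ = proj₁ lowered
  κ′-mono = proj₁ (proj₂ lowered)
  κ≡ = proj₂ (proj₂ lowered)
  lis-∷ : ∀ b → lis w ≤ lis (b ∷ w)
  lis-∷ true  = n≤1+n _
  lis-∷ false = m≤m⊔n _ _
... | zero = cons b refl
  where
  lowered = lower (κ ∘ suc) (κ-mono ∘ s≤s) (tail-positive κ κ-mono)
  κ′ = proj₁ lowered
  κ′-mono = proj₁ (proj₂ lowered)
  κ≡ = proj₂ (proj₂ lowered)
  cons : ∀ b′ → b ≡ b′ → suc k ≤ lis (b′ ∷ w)
  cons true  _    = s≤s (chain⇒≤lis w (chain κ′ κ′-mono λ {i} {j} i<j →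
    trans (cong (lookup (b ∷ w)) (sym (κ≡ i))) ∘ κ-tf (s≤s i<j) ∘ trans (cong (lookup (b ∷ w)) (κ≡ j))))
  cons false refl = ≤-trans (s≤s (falses≤zeros w κ′ κ′-mono allFalse)) (m≤n⊔m (lis w) _)
    where
    allFalse : ∀ i → lookup w (κ′ i) ≡ false
    allFalse i with lookup w (κ′ i) in eq
    ... | false = refl
    ... | true  = trans (sym (κ-tf {zero} {suc i} z<s (trans (cong (lookup (b ∷ w)) (κ≡ i)) eq))) (cong (lookup (b ∷ w)) κ₀≡)

zerosIndex : (w : Word m) → Σ (Fin (zeros w) → Fin m) λ κ → StrictlyMonotone κ × (∀ i → lookup w (κ i) ≡ false)
zerosIndex [] = (λ ()) , (λ { {()} }) , λ ()
zerosIndex (true ∷ w) with κ , κ-mono , κ-false ← zerosIndex w = suc ∘ κ , s≤s ∘ κ-mono , κ-false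
zerosIndex (false ∷ w) with κ , κ-mono , κ-false ← zerosIndex w =
  lift 1 κ , lift-strictlyMonotone κ-mono , λ { zero → refl ; (suc i) → κ-false i }

-- With `chain⇒≤lis` this shows that `lis w` is the maximal length of a chain.
longestChain : (w : Word m) → Chain w (lis w)
longestChain [] = chain (λ ()) (λ { {()} }) (λ { {()} })
longestChain (true ∷ w) with chain κ κ-mono κ-tf ← longestChain w =
  chain (lift 1 κ) (lift-strictlyMonotone κ-mono) λ { {zero} _ _ → refl ; {suc i} {suc j} (s≤s i<j) → κ-tf i<j }
longestChain (false ∷ w) with ⊔-sel (lis w) (suc (zeros w))
... | inj₁ eq with chain κ κ-mono κ-tf ← longestChain w = subst (Chain (false ∷ w)) (sym eq) (chain (suc ∘ κ) (s≤s ∘ κ-mono) κ-tf)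
... | inj₂ eq with κ , κ-mono , κ-false ← zerosIndex w = subst (Chain (false ∷ w)) (sym eq)
  (chain (lift 1 κ) (lift-strictlyMonotone κ-mono) λ { {j = suc j} _ p → contradiction (trans (sym (κ-false j)) p) λ () })

truncate : {w : Word m} → k ≤ l → Chain w l → Chain w k
truncate k≤l (chain κ κ-mono κ-tf) = chain (λ i → κ (inject≤ i k≤l))
  (κ-mono ∘ inject≤-strictlyMonotone k≤l) (κ-tf ∘ inject≤-strictlyMonotone k≤l)

-- Permutations and words

-- The letters true of w mark the values that σ puts at the positions below d.
record Split (w : Word m) (d : ℕ) (σ : Permutation′ m) : Set where
  field
    true⇒<  : ∀ v → lookup w v ≡ true → toℕ (σ ⟨$⟩ˡ v) < d
    false⇒≥ : ∀ v → lookup w v ≡ false → d ≤ toℕ (σ ⟨$⟩ˡ v)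
    sameLetter⇒< : ∀ {u v} → lookup w u ≡ lookup w v → u Fin.< v → (σ ⟨$⟩ˡ u) Fin.< (σ ⟨$⟩ˡ v)

  -- With its converse below, this translates the order of positions into the letter condition of
  -- `Chain`.
  trueFirst⇒< : ∀ {u v} → u Fin.< v → (lookup w v ≡ true → lookup w u ≡ true) → (σ ⟨$⟩ˡ u) Fin.< (σ ⟨$⟩ˡ v)
  trueFirst⇒< {u} {v} u<v tf with lookup w u in wu | lookup w v in wv
  ... | true  | true  = sameLetter⇒< (trans wu (sym wv)) u<v
  ... | true  | false = <-≤-trans (true⇒< u wu) (false⇒≥ v wv)
  ... | false | true  = contradiction (tf refl) λ ()
  ... | false | false = sameLetter⇒< (trans wu (sym wv)) u<v

  <⇒trueFirst : ∀ {u v} → (σ ⟨$⟩ˡ u) Fin.< (σ ⟨$⟩ˡ v) → lookup w v ≡ true → lookup w u ≡ true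
  <⇒trueFirst {u} {v} pu<pv wv with lookup w u in wu
  ... | true  = refl
  ... | false = contradiction (<-trans pu<pv (true⇒< v wv)) (≤⇒≯ (false⇒≥ u wu))

open Split

-- Which of two values comes first can be read off the word, whatever the permutation and the block
-- length are.
split-position-< : {w : Word m} {σ τ : Permutation′ m} → Split w d σ → Split w d′ τ →
                   ∀ {u v} → (σ ⟨$⟩ˡ u) Fin.< (σ ⟨$⟩ˡ v) → (τ ⟨$⟩ˡ u) Fin.< (τ ⟨$⟩ˡ v)
split-position-< {w = w} S S′ {u} {v} pu<pv with Fin.<-cmp u v
... | tri< u<v _ _  = trueFirst⇒< S′ u<v (<⇒trueFirst S pu<pv)
... | tri≈ _ refl _ = contradiction pu<pv (<-irrefl refl)
... | tri> _ _ v<u with lookup w u in wu | lookup w v in wv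
...   | true  | false = <-≤-trans (true⇒< S′ u wu) (false⇒≥ S′ v wv)
...   | true  | true  = contradiction pu<pv (<-asym (trueFirst⇒< S v<u λ _ → wv))
...   | false | _     = contradiction pu<pv (<-asym (trueFirst⇒< S v<u λ wu′ → contradiction (trans (sym wu) wu′) λ ()))

-- An order isomorphism of Fin m is the identity.
split-≈ : {w : Word m} {σ τ : Permutation′ m} → Split w d σ → Split w d′ τ → σ ≈ τ
split-≈ {w = w} {σ} {τ} S S′ i = trans (sym (inverseʳ τ)) (cong (τ ⟨$⟩ʳ_) (sym (Fin.≤-antisym i≤j j≤i)))
  where
  shift-mono : ∀ {d d′ σ τ} → Split w d σ → Split w d′ τ → StrictlyMonotone (λ i → τ ⟨$⟩ˡ (σ ⟨$⟩ʳ i))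
  shift-mono {σ = σ} S S′ i<j = split-position-< S S′ (subst₂ Fin._<_ (sym (inverseˡ σ)) (sym (inverseˡ σ)) i<j)
  j = τ ⟨$⟩ˡ (σ ⟨$⟩ʳ i)
  i≤j : i Fin.≤ j
  i≤j = strictlyMonotone⇒inflationary _ (shift-mono S S′) i
  -- The inverse map, from the positions of `τ` to those of `σ`, sends `j` back to `i`.
  j≤i : j Fin.≤ i
  j≤i = subst (j Fin.≤_) (trans (cong (σ ⟨$⟩ˡ_) (inverseʳ τ)) (inverseˡ σ))
    (strictlyMonotone⇒inflationary _ (shift-mono S′ S) j)

-- Values increase within each block, so a descent must step from the first block into the second.
split-descent : {w : Word m} {σ : Permutation′ m} → Split w d σ → ∀ i → IsDescent σ i → suc (toℕ i) ≡ d
split-descent {d = d} {w = w} {σ} S i (i⁺ , i⁺≡1+i , σi⁺<σi) with lookup w (σ ⟨$⟩ʳ i⁺) in wu | lookup w (σ ⟨$⟩ʳ i) in wv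
... | false | true = ≤-antisym
  (subst (λ j → toℕ j < d) (inverseˡ σ) (true⇒< S _ wv))
  (subst (d ≤_) (trans (cong toℕ (inverseˡ σ)) i⁺≡1+i) (false⇒≥ S _ wu))
... | true | b = contradiction (trueFirst⇒< S σi⁺<σi λ _ → wu)
  (subst₂ (λ a b → ¬ a Fin.< b) (sym (inverseˡ σ)) (sym (inverseˡ σ)) λ i⁺<i → <-asym i⁺<i (≤-reflexive (sym i⁺≡1+i)))
... | false | false = contradiction (trueFirst⇒< S σi⁺<σi λ wv′ → contradiction (trans (sym wv) wv′) λ ())
  (subst₂ (λ a b → ¬ a Fin.< b) (sym (inverseˡ σ)) (sym (inverseˡ σ)) λ i⁺<i → <-asym i⁺<i (≤-reflexive (sym i⁺≡1+i)))

split-grassmannian : {w : Word m} {σ : Permutation′ m} → Split w d σ → IsGrassmannian σ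
split-grassmannian S i j di dj = Fin.toℕ-injective (suc-injective (trans (split-descent S i di) (sym (split-descent S j dj))))

-- The common `d` matters: the identity is split by a different word for each block length.
split-word-unique : {w w′ : Word m} {σ : Permutation′ m} → Split w d σ → Split w′ d σ → w ≡ w′
split-word-unique {w = w} {w′} S S′ = trans (sym (tabulate∘lookup w)) (trans (tabulate-cong same) (tabulate∘lookup w′))
  where
  same : ∀ v → lookup w v ≡ lookup w′ v
  same v with lookup w v in wv | lookup w′ v in w′v
  ... | true  | true  = refl
  ... | true  | false = contradiction (true⇒< S v wv) (≤⇒≯ (false⇒≥ S′ v w′v))
  ... | false | true  = contradiction (true⇒< S′ v w′v) (≤⇒≯ (false⇒≥ S v wv))
  ... | false | false = refl

≈⇒position-≡ : (σ τ : Permutation′ m) → σ ≈ τ → ∀ v → σ ⟨$⟩ˡ v ≡ τ ⟨$⟩ˡ v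
≈⇒position-≡ σ τ σ≈τ v = trans (sym (inverseˡ τ)) (cong (τ ⟨$⟩ˡ_) (trans (sym (σ≈τ _)) (inverseʳ σ)))

split-resp-≈ : {w : Word m} {σ τ : Permutation′ m} → σ ≈ τ → Split w d σ → Split w d τ
split-resp-≈ {d = d} {σ = σ} {τ} σ≈τ S = record
  { true⇒<       = λ v wv → subst (λ p → toℕ p < d) (≈⇒position-≡ σ τ σ≈τ v) (true⇒< S v wv)
  ; false⇒≥      = λ v wv → subst (λ p → d ≤ toℕ p) (≈⇒position-≡ σ τ σ≈τ v) (false⇒≥ S v wv)
  ; sameLetter⇒< = λ {u} {v} eq u<v → subst₂ Fin._<_ (≈⇒position-≡ σ τ σ≈τ u) (≈⇒position-≡ σ τ σ≈τ v) (sameLetter⇒< S eq u<v)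
  }

-- The chain consists of the values of the subsequence; its increasing positions supply the letter
-- condition.
split-contains⇒chain : {w : Word m} {σ : Permutation′ m} → Split w d σ → Contains σ (id {k}) → Chain w k
split-contains⇒chain {σ = σ} S (ι , ι-mono , ι-iso) = chain (λ i → σ ⟨$⟩ʳ ι i)
  (λ {i} {j} → Equivalence.to (ι-iso i j))
  (λ {i} {j} i<j → <⇒trueFirst S (subst₂ Fin._<_ (sym (inverseˡ σ)) (sym (inverseˡ σ)) (ι-mono i j i<j)))

split-chain⇒contains : {w : Word m} {σ : Permutation′ m} → Split w d σ → Chain w k → Contains σ (id {k})
split-chain⇒contains {σ = σ} S (chain κ κ-mono κ-tf) = increasing⇒contains-id σ (λ i → σ ⟨$⟩ˡ κ i)
  (λ i<j → trueFirst⇒< S (κ-mono i<j) (κ-tf i<j))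
  (λ i<j → subst₂ Fin._<_ (sym (inverseʳ σ)) (sym (inverseʳ σ)) (κ-mono i<j))

split-avoids⇒lis< : {w : Word m} {σ : Permutation′ m} → Split w d σ → Avoids σ (id {k}) → lis w < k
split-avoids⇒lis< {k = k} {w = w} S avoids with lis w <? k
... | yes lis<k = lis<k
... | no  lis≮k = contradiction (split-chain⇒contains S (truncate (≮⇒≥ lis≮k) (longestChain w))) avoids

split-lis<⇒avoids : {w : Word m} {σ : Permutation′ m} → Split w d σ → lis w < k → Avoids σ (id {k})
split-lis<⇒avoids {w = w} S lis<k contains = <⇒≱ lis<k (chain⇒≤lis w (split-contains⇒chain S contains))

-- From words to permutations

ones : Word m → Fin (suc m)
ones []          = zero
ones (true ∷ w)  = suc (ones w)
ones (false ∷ w) = inject₁ (ones w)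

-- The value 0 comes first in its block; the two blocks start at 0 and ones w.
positions : Word m → Permutation′ m
positions []          = id
positions (true ∷ w)  = insert zero zero (positions w)
positions (false ∷ w) = insert zero (ones w) (positions w)

fromWord : Word m → Permutation′ m
fromWord w = flip (positions w)

punchIn-mono-< : ∀ i {x y : Fin m} → x Fin.< y → punchIn i x Fin.< punchIn i y
punchIn-mono-< i {x} {y} x<y = ≰⇒> λ p → <⇒≱ x<y (Fin.punchIn-cancel-≤ i y x p)

x<i⇒punchIn-i-x<i : (i : Fin (suc m)) (x : Fin m) → x Fin.< i → punchIn i x Fin.< i
x<i⇒punchIn-i-x<i (suc i) zero    _         = z<s
x<i⇒punchIn-i-x<i (suc i) (suc x) (s≤s x<i) = s≤s (x<i⇒punchIn-i-x<i i x x<i)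

i≤x⇒i<punchIn-i-x : (i : Fin (suc m)) (x : Fin m) → i Fin.≤ x → i Fin.< punchIn i x
i≤x⇒i<punchIn-i-x zero    x       _         = z<s
i≤x⇒i<punchIn-i-x (suc i) (suc x) (s≤s i≤x) = s≤s (i≤x⇒i<punchIn-i-x i x i≤x)

-- A new `true` moves every position up by one. A new `false` opens a gap at `ones w`, so `punchIn`
-- keeps the first block below it and pushes the second above it.
fromWord-split : (w : Word m) → Split w (toℕ (ones w)) (fromWord w)
fromWord-split [] = record { true⇒< = λ () ; false⇒≥ = λ () ; sameLetter⇒< = λ { {()} } }
fromWord-split (true ∷ w) = record
  { true⇒<       = λ { zero _ → z<s ; (suc v) wv → s≤s (true⇒< S v wv) }
  ; false⇒≥      = λ { (suc v) wv → s≤s (false⇒≥ S v wv) }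
  ; sameLetter⇒< = λ { {zero} {suc v} _ _ → z<s ; {suc u} {suc v} eq (s≤s u<v) → s≤s (sameLetter⇒< S eq u<v) }
  }
  where S = fromWord-split w
fromWord-split (false ∷ w) rewrite Fin.toℕ-inject₁ (ones w) = record
  { true⇒<       = λ { (suc v) wv → x<i⇒punchIn-i-x<i (ones w) _ (true⇒< S v wv) }
  ; false⇒≥      = λ { zero _ → ≤-refl ; (suc v) wv → <⇒≤ (i≤x⇒i<punchIn-i-x (ones w) _ (false⇒≥ S v wv)) }
  ; sameLetter⇒< = λ
    { {zero} {suc v} eq _ → i≤x⇒i<punchIn-i-x (ones w) _ (false⇒≥ S v (sym eq))
    ; {suc u} {suc v} eq (s≤s u<v) → punchIn-mono-< (ones w) (sameLetter⇒< S eq u<v) }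
  }
  where S = fromWord-split w

-- From permutations to words

isDescent? : (σ : Permutation′ m) (i : Fin m) → Dec (IsDescent σ i)
isDescent? σ i = Fin.any? λ i⁺ → (toℕ i⁺ ≟ suc (toℕ i)) ×-dec ((σ ⟨$⟩ʳ i⁺) Fin.<? (σ ⟨$⟩ʳ i))

⟨$⟩ʳ-injective : (σ : Permutation′ m) {i j : Fin m} → σ ⟨$⟩ʳ i ≡ σ ⟨$⟩ʳ j → i ≡ j
⟨$⟩ʳ-injective σ eq = trans (sym (inverseˡ σ)) (trans (cong (σ ⟨$⟩ˡ_) eq) (inverseˡ σ))

noDescent⇒< : (σ : Permutation′ m) {i j : Fin m} → toℕ j ≡ suc (toℕ i) → ¬ IsDescent σ i → (σ ⟨$⟩ʳ i) Fin.< (σ ⟨$⟩ʳ j)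
noDescent⇒< σ {i} {j} j≡1+i ¬descent with Fin.<-cmp (σ ⟨$⟩ʳ i) (σ ⟨$⟩ʳ j)
... | tri< lt _ _ = lt
... | tri≈ _ eq _ = contradiction (trans (sym j≡1+i) (cong toℕ (sym (⟨$⟩ʳ-injective σ eq)))) 1+n≢n
... | tri> _ _ gt = contradiction (j , j≡1+i , gt) ¬descent

noDescentsBetween⇒< : (σ : Permutation′ m) {p q : Fin m} → p Fin.< q →
                      (∀ r → p Fin.≤ r → r Fin.< q → ¬ IsDescent σ r) → (σ ⟨$⟩ʳ p) Fin.< (σ ⟨$⟩ʳ q)
-- The recursion is on the number of positions strictly between `p` and `q`, and moves `q` to the
-- left.
noDescentsBetween⇒< σ {p} {q} p<q = go (toℕ q ∸ suc (toℕ p)) q (sym (m+[n∸m]≡n p<q))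
  where
  go : ∀ n q → toℕ q ≡ suc (toℕ p + n) → (∀ r → p Fin.≤ r → r Fin.< q → ¬ IsDescent σ r) → (σ ⟨$⟩ʳ p) Fin.< (σ ⟨$⟩ʳ q)
  go zero    q       q≡ ¬descent = noDescent⇒< σ q≡1+p (¬descent p ≤-refl (≤-reflexive (sym q≡1+p)))
    where q≡1+p = trans q≡ (cong suc (+-identityʳ (toℕ p)))
  go (suc n) (suc q) q≡ ¬descent = <-trans
    (go n r r≡ λ s p≤s s<r → ¬descent s p≤s (<-trans s<r r<q))
    (noDescent⇒< σ (cong suc (sym (Fin.toℕ-inject₁ q))) (¬descent r p≤r r<q))
    where
    r = inject₁ q
    r≡ : toℕ r ≡ suc (toℕ p + n)
    r≡ = trans (Fin.toℕ-inject₁ q) (trans (suc-injective q≡) (+-suc (toℕ p) n))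
    r<q : r Fin.< suc q
    r<q = s≤s (≤-reflexive (Fin.toℕ-inject₁ q))
    p≤r : p Fin.≤ r
    p≤r = ≤-trans (m≤n⇒m≤1+n (m≤m+n (toℕ p) n)) (≤-reflexive (sym r≡))

-- Without a descent the first `k` entries already increase. This excludes the identity, the one
-- permutation with several words.
avoids⇒descent : k ≤ m → (σ : Permutation′ m) → Avoids σ (id {k}) → ∃ (IsDescent σ)
avoids⇒descent k≤m σ avoids with Fin.any? (isDescent? σ)
... | yes descent  = descent
... | no  ¬descent = contradiction
  (increasing⇒contains-id σ (λ i → inject≤ i k≤m) (inject≤-strictlyMonotone k≤m)
    λ i<j → noDescentsBetween⇒< σ (inject≤-strictlyMonotone k≤m i<j) λ r _ _ d → ¬descent (r , d))
  avoids

-- `i` is meant to be the descent, which is the last position of the first block; hence `≤` here and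
-- block length `suc (toℕ i)` in `toWord-split`.
toWord : Permutation′ m → Fin m → Word m
toWord σ i = tabulate λ v → does ((σ ⟨$⟩ˡ v) Fin.≤? i)

toWord-split : (σ : Permutation′ m) → IsGrassmannian σ → ∀ {i} → IsDescent σ i → Split (toWord σ i) (suc (toℕ i)) σ
toWord-split σ grassmannian {i} descent = record
  { true⇒<       = λ v wv → s≤s (first v wv)
  ; false⇒≥      = second
  ; sameLetter⇒< = same
  }
  where
  letter : ∀ v → lookup (toWord σ i) v ≡ does ((σ ⟨$⟩ˡ v) Fin.≤? i)
  letter = lookup∘tabulate _
  first : ∀ v → lookup (toWord σ i) v ≡ true → (σ ⟨$⟩ˡ v) Fin.≤ i
  first v wv with (σ ⟨$⟩ˡ v) Fin.≤? i
  ... | yes p≤i = p≤i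
  ... | no  p≰i = contradiction (trans (sym wv) (trans (letter v) (dec-false ((σ ⟨$⟩ˡ v) Fin.≤? i) p≰i))) λ ()
  second : ∀ v → lookup (toWord σ i) v ≡ false → i Fin.< (σ ⟨$⟩ˡ v)
  second v wv with (σ ⟨$⟩ˡ v) Fin.≤? i
  ... | no  p≰i = ≰⇒> p≰i
  ... | yes p≤i = contradiction (trans (sym wv) (trans (letter v) (dec-true ((σ ⟨$⟩ˡ v) Fin.≤? i) p≤i))) λ ()
  sameLetter⇒sameBlock : ∀ {u v} → lookup (toWord σ i) u ≡ lookup (toWord σ i) v → (σ ⟨$⟩ˡ u) Fin.≤ i → ¬ (i Fin.< (σ ⟨$⟩ˡ v))
  sameLetter⇒sameBlock {u} {v} eq pu≤i i<pv = contradiction (begin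
    true                                ≡⟨ dec-true ((σ ⟨$⟩ˡ u) Fin.≤? i) pu≤i ⟨
    does ((σ ⟨$⟩ˡ u) Fin.≤? i)          ≡⟨ letter u ⟨
    lookup (toWord σ i) u               ≡⟨ eq ⟩
    lookup (toWord σ i) v               ≡⟨ letter v ⟩
    does ((σ ⟨$⟩ˡ v) Fin.≤? i)          ≡⟨ dec-false ((σ ⟨$⟩ˡ v) Fin.≤? i) (<⇒≱ i<pv) ⟩
    false                               ∎) λ ()
    where open ≡-Reasoning
  same : ∀ {u v} → lookup (toWord σ i) u ≡ lookup (toWord σ i) v → u Fin.< v → (σ ⟨$⟩ˡ u) Fin.< (σ ⟨$⟩ˡ v)
  same {u} {v} eq u<v with Fin.<-cmp (σ ⟨$⟩ˡ u) (σ ⟨$⟩ˡ v)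
  ... | tri< lt _ _ = lt
  ... | tri≈ _ pu≡pv _ = contradiction u<v (<-irrefl (cong toℕ (trans (sym (inverseʳ σ)) (trans (cong (σ ⟨$⟩ʳ_) pu≡pv) (inverseʳ σ)))))
  ... | tri> _ _ pv<pu = contradiction
    (subst₂ Fin._<_ (inverseʳ σ) (inverseʳ σ) (noDescentsBetween⇒< σ pv<pu noDescent))
    (<-asym u<v)
    where
    -- Such a descent could only be at `i`, which would put `v` in the first block and `u` in the
    -- second although their letters agree.
    noDescent : ∀ r → (σ ⟨$⟩ˡ v) Fin.≤ r → r Fin.< (σ ⟨$⟩ˡ u) → ¬ IsDescent σ r
    noDescent r pv≤r r<pu dr with refl ← grassmannian r i dr descent = sameLetter⇒sameBlock (sym eq) pv≤r r<pu

-- The bijection and the count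

ShortWord : ℕ → ℕ → Set
ShortWord m k = Σ (Word m) λ w → T (lis w <ᵇ k)

-- Splitting by the first letter follows the recursion of `total`, with the sum turned into a
-- disjoint union.
subset↔Fin : (p : Word m → Bool) → Σ (Word m) (T ∘ p) ↔ Fin (total λ w → [ p w ])
subset↔Fin {zero} p with p [] in eq
... | true  = mk↔ₛ′ (λ _ → zero) (λ _ → [] , subst T (sym eq) _) (λ { zero → refl }) λ { ([] , t) → cong ([] ,_) (T-irrelevant _ t) }
... | false = mk↔ₛ′ (λ { ([] , t) → contradiction (subst T eq t) λ () }) (λ ()) (λ ()) λ { ([] , t) → contradiction (subst T eq t) λ () }
subset↔Fin {suc m} p = ↔-sym Fin.+↔⊎ ↔-∘ ((subset↔Fin (p ∘ (true ∷_)) ⊎-↔ subset↔Fin (p ∘ (false ∷_))) ↔-∘ byHead)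
  where
  byHead : Σ (Word (suc m)) (T ∘ p) ↔ (Σ (Word m) (T ∘ p ∘ (true ∷_)) ⊎ Σ (Word m) (T ∘ p ∘ (false ∷_)))
  byHead = mk↔ₛ′
    (λ { (true ∷ w , t) → inj₁ (w , t) ; (false ∷ w , t) → inj₂ (w , t) })
    (λ { (inj₁ (w , t)) → true ∷ w , t ; (inj₂ (w , t)) → false ∷ w , t })
    (λ { (inj₁ _) → refl ; (inj₂ _) → refl })
    (λ { (true ∷ w , t) → refl ; (false ∷ w , t) → refl })

-- The round trips are the two uniqueness statements: `split-word-unique` on words and `split-≈` on
-- permutations.
avoiders↔shortWords : k ≤ m → Inverse (permutationsSatisfying {m} (λ σ → IsGrassmannian σ × Avoids σ (id {k}))) (setoid (ShortWord m k))
avoiders↔shortWords {k} {m} k≤m = record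
  { to        = λ s → word s , <⇒<ᵇ (split-avoids⇒lis< (word-split s) (proj₂ (proj₂ s)))
  ; from      = from
  ; to-cong   = λ {s} {t} s≈t → shortWord-≡ (sameWord s t s≈t)
  ; from-cong = λ { refl i → refl }
  ; inverse   = (λ { {w , p} {s} s≈ → shortWord-≡ (sym (split-word-of s (w , p) s≈)) })
              , (λ { {s} refl → split-≈ (fromWord-split (word s)) (word-split s) })
  }
  where
  Avoider : Set
  Avoider = Σ (Permutation′ m) λ σ → IsGrassmannian σ × Avoids σ (id {k})
  descent : (s : Avoider) → ∃ (IsDescent (proj₁ s))
  descent (σ , _ , avoids) = avoids⇒descent k≤m σ avoids
  word : Avoider → Word m
  word s = toWord (proj₁ s) (proj₁ (descent s))
  word-split : (s : Avoider) → Split (word s) (suc (toℕ (proj₁ (descent s)))) (proj₁ s)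
  word-split s@(σ , grassmannian , _) = toWord-split σ grassmannian (proj₂ (descent s))
  from : ShortWord m k → Avoider
  from (w , p) = fromWord w , split-grassmannian (fromWord-split w) , split-lis<⇒avoids (fromWord-split w) (<ᵇ⇒< (lis w) k p)
  shortWord-≡ : {x y : ShortWord m k} → proj₁ x ≡ proj₁ y → x ≡ y
  shortWord-≡ {w , p} {_ , q} refl = cong (w ,_) (T-irrelevant p q)
  word-unique : {w : Word m} (s : Avoider) → Split w d (proj₁ s) → w ≡ word s
  -- `split-descent` identifies `d` with the block length of `word s`, so that both words split at
  -- the same place.
  word-unique {w = w} s S = split-word-unique (subst (λ d → Split w d (proj₁ s)) (sym (split-descent S _ (proj₂ (descent s)))) S) (word-split s)
  sameWord : ∀ s t → proj₁ s ≈ proj₁ t → word s ≡ word t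
  sameWord s t s≈t = word-unique t (split-resp-≈ s≈t (word-split s))
  split-word-of : ∀ s x → proj₁ s ≈ proj₁ (from x) → proj₁ x ≡ word s
  split-word-of s (w , p) s≈ = word-unique s (split-resp-≈ (λ i → sym (s≈ i)) (fromWord-split w))

theorem3p1 : (k m : ℕ) → 2 ≤ k → k ≤ m → m ≤ 2 * k ∸ 2 → ∃ λ n → HasCardinality (permutationsSatisfying {m} (λ σ → IsGrassmannian σ × Avoids σ (id {k}))) n × + n ≡ alternatingSum k m
theorem3p1 k m 2≤k k≤m m≤2k∸2 = short m k , inverse (avoiders↔shortWords k≤m) (subset↔Fin λ w → lis w <ᵇ k) ,
  -- `alternatingSum k m` unfolds to the sum of the first `n` main terms, so the range `N` is `n`
  -- itself.
  sym (subst₂ (λ k′ m′ → MainClosed n k′ m′ n) n+e≡k n+2e≡m (mainSum-closed n e n ≤-refl))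
  where
  -- With these values k = n + e and m = n + 2e, the form in which the closed evaluation is stated.
  n = 2 * k ∸ m
  e = m ∸ k
  m≤2k : m ≤ 2 * k
  m≤2k = ≤-trans m≤2k∸2 (m∸n≤m (2 * k) 2)
  n+m≡2k : n + m ≡ k + k
  n+m≡2k = trans (m∸n+n≡m m≤2k) (cong (_+_ k) (+-identityʳ k))
  n+e≡k : n + e ≡ k
  n+e≡k = +-cancelʳ-≡ k _ _ (trans (+-assoc n e k) (trans (cong (_+_ n) (m∸n+n≡m k≤m)) n+m≡2k))
  n+2e≡m : n + (e + e) ≡ m
  n+2e≡m = trans (sym (+-assoc n e e)) (trans (cong (_+ e) n+e≡k) (m+[n∸m]≡n k≤m))
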